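{- For every $C\in\mathbb{N}^{\ell\times m}$ and $D\in\mathbb{N}^{\ell\times n}$, there exists a Presburger formula $\textsf{BiREG}_{C,D}(\bar X,\bar Y)$ with $\bar X=(X_1,\dots,X_m)$, $\bar Y=(Y_1,\dots,Y_n)$ such that for all $\bar M\in\mathbb{N}^m,\bar N\in\mathbb{N}^n$: there exists an $\ell$-type $(C,D)$-biregular graph of size $(\bar M,\bar N)$ if and only if $\textsf{BiREG}_{C,D}(\bar M,\bar N)$ holds.
   Context: A Presburger formula is a first-order formula with $+,\le,0,1$ interpreted over $\mathbb{N}=\{0,1,2,\dots\}$. An $\ell$-type bipartite graph is $G=(U,V,E_1,\dots,E_\ell)$ with $E_1,\dots,E_\ell$ pairwise disjoint subsets of $U\times V$; $\deg_{E_i}(u)$ is the number of $E_i$-edges incident to $u$. $G$ is $(C,D)$-biregular if there are partitions $U=U_1\cup\dots\cup U_m$, $V=V_1\cup\dots\cup V_n$ (parts may be empty) such that for all $i\le\ell$: $\deg_{E_i}(u)=C_{i,j}$ for all $u\in U_j$ and $\deg_{E_i}(v)=D_{i,j}$ for all $v\in V_j$; it has size $(\bar M,\bar N)$ if the partitions can be chosen with $\bar M=(|U_1|,\dots,|U_m|)$, $\bar N=(|V_1|,\dots,|V_n|)$. -}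

module Defs where

open import Data.Nat using (ℕ; zero; suc; _+_; _≤_)
open import Data.Fin using (Fin; _≟_)
open import Data.Bool using (Bool; true; false; if_then_else_)
open import Data.List using (List; map)
open import Data.Nat.ListAction using (sum)
open import Data.List.Base using (allFin)
open import Data.Product using (Σ; _×_; ∃)
open import Data.Sum using (_⊎_)
open import Data.Unit using (⊤)
open import Data.Empty using (⊥)
open import Relation.Nullary using (¬_)
open import Relation.Nullary.Decidable using (⌊_⌋)
open import Relation.Binary.PropositionalEquality using (_≡_)
open import Data.Vec.Functional using (_∷_)

-- Presburger arithmetic: first-order logic over (ℕ, +, ≤, 0, 1) with
-- equality.  Variables are de Bruijn indices: a term/formula in context
-- k has k variables available (Fin k).

data Term (k : ℕ) : Set where
  var  : Fin k → Term k
  `0   : Term k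
  `1   : Term k
  _`+_ : Term k → Term k → Term k

data Formula (k : ℕ) : Set where
  _`≤_  : Term k → Term k → Formula k
  _`≡_  : Term k → Term k → Formula k
  `⊤ `⊥ : Formula k
  `¬_   : Formula k → Formula k
  _`∧_  : Formula k → Formula k → Formula k
  _`∨_  : Formula k → Formula k → Formula k
  _`⇒_  : Formula k → Formula k → Formula k
  `∀    : Formula (suc k) → Formula k   -- binds variable index zero
  `∃    : Formula (suc k) → Formula k

evalT : ∀ {k} → Term k → (Fin k → ℕ) → ℕ
evalT (var i)    ρ = ρ i
evalT `0         ρ = 0
evalT `1         ρ = 1
evalT (s `+ t)   ρ = evalT s ρ + evalT t ρ

Sat : ∀ {k} → Formula k → (Fin k → ℕ) → Set
Sat (s `≤ t) ρ = evalT s ρ ≤ evalT t ρ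
Sat (s `≡ t) ρ = evalT s ρ ≡ evalT t ρ
Sat `⊤       ρ = ⊤
Sat `⊥       ρ = ⊥
Sat (`¬ φ)   ρ = ¬ Sat φ ρ
Sat (φ `∧ ψ) ρ = Sat φ ρ × Sat ψ ρ
Sat (φ `∨ ψ) ρ = Sat φ ρ ⊎ Sat ψ ρ
Sat (φ `⇒ ψ) ρ = Sat φ ρ → Sat ψ ρ
Sat (`∀ φ)   ρ = (x : ℕ) → Sat φ (x ∷ ρ)
Sat (`∃ φ)   ρ = Σ ℕ (λ x → Sat φ (x ∷ ρ))

-- ℓ-type bipartite graphs with U = Fin p, V = Fin q.
-- E i u v = true  iff  (u , v) ∈ E_i.

record BipGraph (ℓ p q : ℕ) : Set where
  field
    E        : Fin ℓ → Fin p → Fin q → Bool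
    disjoint : ∀ i j u v → E i u v ≡ true → E j u v ≡ true → i ≡ j
open BipGraph public

countB : ∀ {k} → (Fin k → Bool) → ℕ
countB {k} f = sum (map (λ x → if f x then 1 else 0) (allFin k))

degU : ∀ {ℓ p q} → BipGraph ℓ p q → Fin ℓ → Fin p → ℕ
degU G i u = countB (λ v → E G i u v)

degV : ∀ {ℓ p q} → BipGraph ℓ p q → Fin ℓ → Fin q → ℕ
degV G i v = countB (λ u → E G i u v)

-- A partition of U into (possibly empty) parts U_1..U_m is given by the
-- map sending each vertex to the index of its part.
-- G is (C,D)-biregular of size (M,N) w.r.t. partitions pu, pv:
IsBiregularOfSize : ∀ {ℓ m n p q} →
  (C : Fin ℓ → Fin m → ℕ) (D : Fin ℓ → Fin n → ℕ) →
  (M : Fin m → ℕ) (N : Fin n → ℕ) →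
  BipGraph ℓ p q → (Fin p → Fin m) → (Fin q → Fin n) → Set
IsBiregularOfSize C D M N G pu pv =
  (∀ i u → degU G i u ≡ C i (pu u)) ×
  (∀ i v → degV G i v ≡ D i (pv v)) ×
  (∀ j → countB (λ u → ⌊ pu u ≟ j ⌋) ≡ M j) ×
  (∀ j → countB (λ v → ⌊ pv v ≟ j ⌋) ≡ N j)

ExistsBiregular : ∀ {ℓ m n} →
  (C : Fin ℓ → Fin m → ℕ) (D : Fin ℓ → Fin n → ℕ) →
  (M : Fin m → ℕ) (N : Fin n → ℕ) → Set
ExistsBiregular {ℓ} {m} {n} C D M N =
  Σ ℕ λ p → Σ ℕ λ q → Σ (BipGraph ℓ p q) λ G →
  Σ (Fin p → Fin m) λ pu → Σ (Fin q → Fin n) λ pv →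
  IsBiregularOfSize C D M N G pu pv

{-# OPTIONS --safe #-}
module Submission where

-- Put a suitable threshold T, quadratic in the entries of C and D.  If some type
-- i has more than T edges, then a graph of the remaining types can be extended
-- by type i as soon as the edge counts of type i agree on the two sides: realise
-- the degrees by a multigraph, and remove collisions one edge at a time by
-- switching  (u,v), (u′,v′)  to  (u,v′), (u′,v).  All degrees are bounded, so a
-- given edge has at most T unsuitable partners.  If no type has more than T
-- edges, every class with a nonzero degree has at most T vertices, while classes
-- of isolated vertices have arbitrary size; this leaves finitely many cases.
-- The formula follows by recursion on the number of types.

open import Defs
open import Data.Nat using (ℕ; zero; suc; _+_; _*_; _^_; _≤_; _<_; z≤n; s≤s; ≢-nonZero)
open import Data.Nat.Properties as ℕ hiding (_≟_)
import Data.Nat.ListAction as List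
open import Data.Bool as Bool using (Bool; true; false; if_then_else_)
open import Data.Fin using (Fin; zero; suc; toℕ; fromℕ<; _≟_; _↑ˡ_; _↑ʳ_; splitAt; punchIn; punchOut; funToFin; finToFun)
open import Data.Fin.Properties using (any?; all?; 2↔Bool; toℕ-fromℕ<; finToFun-funToFin; punchIn-injective; punchIn-punchOut)
open import Data.Fin.Permutation using (transpose; _⟨$⟩ʳ_)
open import Data.List using ([]; _∷_; map; tabulate; allFin)
open import Data.List.Relation.Unary.All as All using (All; []; _∷_)
open import Data.List.Membership.Propositional.Properties using (∈-allFin)
open import Data.Product using (Σ; ∃; _×_; _,_; proj₁; proj₂)
open import Data.Sum using (_⊎_; inj₁; inj₂)
open import Data.Unit using (tt)
open import Data.Vec.Functional using (_++_; replicate; removeAt; insertAt) renaming (_∷_ to _∷ᶠ_)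
open import Data.Vec.Functional.Properties using (lookup-++ˡ; lookup-++ʳ; insertAt-lookup; insertAt-punchIn)
open import Function using (_∘_; id)
open import Function.Bundles using (_⇔_; Inverse; mk⇔)
open import Relation.Nullary using (¬_; Dec; yes; no; contradiction)
open import Relation.Nullary.Decidable using (⌊_⌋; _×-dec_; _→-dec_; ¬?; decidable-stable; map′)
open import Relation.Binary.PropositionalEquality using (_≡_; _≢_; _≗_; refl; sym; trans; cong; cong₂; subst; subst₂; module ≡-Reasoning)
open import Algebra.Properties.Semiring.Sum +-*-semiring using (sum; sum-syntax; sum-cong-≗; sum-replicate-zero; sum-remove; sum-permute; ∑-distrib-+; ∑-comm; *-distribˡ-sum; *-distribʳ-sum)

-- Finite sums, Kronecker deltas and fibres of maps.

⟦_⟧ : Bool → ℕ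
⟦ b ⟧ = if b then 1 else 0

δ : ∀ {n} → Fin n → Fin n → ℕ
δ i j = ⟦ ⌊ i ≟ j ⌋ ⟧

δ-refl : ∀ {n} (i : Fin n) → δ i i ≡ 1
δ-refl i with i ≟ i
... | yes _  = refl
... | no i≢i = contradiction refl i≢i

δ-≢ : ∀ {n} {i j : Fin n} → i ≢ j → δ i j ≡ 0
δ-≢ {i = i} {j} i≢j with i ≟ j
... | yes i≡j = contradiction i≡j i≢j
... | no _    = refl

δ-suc : ∀ {n} (i j : Fin n) → δ (suc i) (suc j) ≡ δ i j
δ-suc i j with i ≟ j
... | yes _ = refl
... | no _  = refl

∑-mono : ∀ {n} {f g : Fin n → ℕ} → (∀ i → f i ≤ g i) → sum f ≤ sum g
∑-mono {zero}  f≤g = z≤n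
∑-mono {suc n} f≤g = +-mono-≤ (f≤g zero) (∑-mono (f≤g ∘ suc))

∑-zero : ∀ {n} {f : Fin n → ℕ} → (∀ i → f i ≡ 0) → sum f ≡ 0
∑-zero {n} f≡0 = trans (sum-cong-≗ f≡0) (sum-replicate-zero n)

term≤∑ : ∀ {n} (f : Fin n → ℕ) i → f i ≤ sum f
term≤∑ f zero    = m≤m+n _ _
term≤∑ f (suc i) = ≤-trans (term≤∑ (f ∘ suc) i) (m≤n+m _ _)

∑≡0⇒term≡0 : ∀ {n} (f : Fin n → ℕ) → sum f ≡ 0 → ∀ i → f i ≡ 0
∑≡0⇒term≡0 f f≡0 i = n≤0⇒n≡0 (subst (f i ≤_) f≡0 (term≤∑ f i))

∑-one : ∀ n → ∑[ i < n ] 1 ≡ n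
∑-one zero    = refl
∑-one (suc n) = cong suc (∑-one n)

∑-δ : ∀ {n} (g : Fin n → ℕ) i → ∑[ j < n ] (δ i j * g j) ≡ g i
∑-δ {suc n} g zero =
  trans (cong₂ _+_ (+-identityʳ (g zero)) (sum-replicate-zero n)) (+-identityʳ (g zero))
∑-δ g (suc i) =
  trans (sum-cong-≗ (λ j → cong (_* g (suc j)) (δ-suc i j))) (∑-δ (g ∘ suc) i)

∑δ≡1 : ∀ {n} (i : Fin n) → ∑[ j < n ] δ i j ≡ 1
∑δ≡1 i = trans (sum-cong-≗ (λ j → sym (*-identityʳ (δ i j)))) (∑-δ (λ _ → 1) i)

∑-split : ∀ {m n} (f : Fin (m + n) → ℕ) →
          sum f ≡ ∑[ i < m ] f (i ↑ˡ n) + ∑[ j < n ] f (m ↑ʳ j)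
∑-split {zero}  f = refl
∑-split {suc m} f = trans (cong (f zero +_) (∑-split {m} (f ∘ suc))) (sym (+-assoc (f zero) _ _))

∑-++ : ∀ {A : Set} {m n} (h : A → ℕ) (f : Fin m → A) (g : Fin n → A) →
       sum (h ∘ (f ++ g)) ≡ sum (h ∘ f) + sum (h ∘ g)
∑-++ {m = m} h f g = trans (∑-split {m} (h ∘ (f ++ g)))
  (cong₂ _+_ (sum-cong-≗ (cong h ∘ lookup-++ˡ f g)) (sum-cong-≗ (cong h ∘ lookup-++ʳ f g)))

∑-∘ : ∀ {p m} (f : Fin p → Fin m) (g : Fin m → ℕ) →
      ∑[ u < p ] g (f u) ≡ ∑[ j < m ] ((∑[ u < p ] δ (f u) j) * g j)
∑-∘ {p} {m} f g = begin
  ∑[ u < p ] g (f u)                          ≡⟨ sum-cong-≗ (λ u → sym (∑-δ g (f u))) ⟩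
  ∑[ u < p ] ∑[ j < m ] (δ (f u) j * g j)     ≡⟨ ∑-comm (λ u j → δ (f u) j * g j) ⟩
  ∑[ j < m ] ∑[ u < p ] (δ (f u) j * g j)     ≡⟨ sum-cong-≗ (λ j → sym (*-distribʳ-sum (g j) (λ u → δ (f u) j))) ⟩
  ∑[ j < m ] ((∑[ u < p ] δ (f u) j) * g j)   ∎
  where open ≡-Reasoning

-- Used in two ways: for a degree sequence `T` it lists edge ends, each vertex as often as its
-- degree; for class sizes it supplies the vertices of each class.
fibres : ∀ {m} (T : Fin m → ℕ) →
         Σ (Fin (sum T) → Fin m) λ f → ∀ j → ∑[ u < sum T ] δ (f u) j ≡ T j
fibres {zero}  T = (λ ()) , λ ()
fibres {suc m} T with fibres (T ∘ suc)
... | f , f-fibre = replicate (T zero) zero ++ (suc ∘ f) , λ where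
  zero    → trans (∑-++ (λ i → δ i zero) (replicate (T zero) zero) (suc ∘ f))
              (trans (cong₂ _+_ (∑-one (T zero)) (∑-zero {f = λ u → δ (suc (f u)) zero} λ _ → refl))
                     (+-identityʳ _))
  (suc j) → trans (∑-++ (λ i → δ i (suc j)) (replicate (T zero) zero) (suc ∘ f))
              (cong₂ _+_ (∑-zero {f = replicate (T zero) 0} λ _ → refl) (trans (sum-cong-≗ (λ u → δ-suc (f u) j)) (f-fibre j)))

countB-∑ : ∀ {n} (f : Fin n → Bool) → countB f ≡ ∑[ i < n ] ⟦ f i ⟧
countB-∑ f = go f id
  where
  go : ∀ {k n} (f : Fin k → Bool) (g : Fin n → Fin k) →
       List.sum (map (λ x → ⟦ f x ⟧) (tabulate g)) ≡ ∑[ i < n ] ⟦ f (g i) ⟧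
  go {n = zero}  f g = refl
  go {n = suc n} f g = cong (⟦ f (g zero) ⟧ +_) (go f (g ∘ suc))

-- Bipartite multigraphs and the switching of edges.

∑-∘-≤ : ∀ {t q Δ B} (f : Fin t → Fin q) (g : Fin q → ℕ) →
        (∀ v → ∑[ z < t ] δ (f z) v ≤ Δ) → sum g ≤ B → sum (g ∘ f) ≤ Δ * B
∑-∘-≤ {t} {q} {Δ} {B} f g fibre≤Δ ∑g≤B = begin
  sum (g ∘ f)                                ≡⟨ ∑-∘ f g ⟩
  ∑[ v < q ] ((∑[ z < t ] δ (f z) v) * g v)  ≤⟨ ∑-mono (λ v → *-monoˡ-≤ (g v) (fibre≤Δ v)) ⟩
  ∑[ v < q ] (Δ * g v)                       ≡⟨ *-distribˡ-sum Δ g ⟨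
  Δ * sum g                                  ≤⟨ *-monoʳ-≤ Δ ∑g≤B ⟩
  Δ * B                                      ∎
  where open ≤-Reasoning

-- An upper bound on the number of edges that cannot be switched with a given
-- one when all degrees are at most Δ.
threshold : ℕ → ℕ
threshold Δ = Δ * (Δ + Δ) + Δ * (Δ + Δ)

transpose-cases : ∀ {n} (x y w : Fin n) → let w′ = transpose x y ⟨$⟩ʳ w in
                  (w ≡ x × w′ ≡ y) ⊎ (w ≡ y × w′ ≡ x) ⊎ w′ ≡ w
transpose-cases x y w with w ≟ x
... | yes w≡x = inj₁ (w≡x , refl)
... | no _ with w ≟ y
...   | yes w≡y = inj₂ (inj₁ (w≡y , refl))
...   | no _    = inj₂ (inj₂ refl)

transposeˡ : ∀ {n} (x y : Fin n) → transpose x y ⟨$⟩ʳ x ≡ y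
transposeˡ x y with x ≟ x
... | yes _   = refl
... | no x≢x = contradiction refl x≢x

transposeʳ : ∀ {n} (x y : Fin n) → transpose x y ⟨$⟩ʳ y ≡ x
transposeʳ x y with transpose-cases x y y
... | inj₁ (y≡x , e)      = trans e y≡x
... | inj₂ (inj₁ (_ , e)) = e
... | inj₂ (inj₂ e) with y ≟ x
...   | yes y≡x = y≡x
...   | no _ with y ≟ y
...     | yes _  = refl
...     | no y≢y = contradiction refl y≢y

switch : ∀ {t q} → Fin t → Fin t → (Fin t → Fin q) → Fin t → Fin q
switch x y r z = r (transpose x y ⟨$⟩ʳ z)

-- A multigraph is a list of t edges, the z-th one joining s z to r z.
module _ {p q t : ℕ} (s : Fin t → Fin p) where

  mult : (Fin t → Fin q) → Fin p → Fin q → ℕ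
  mult r u v = ∑[ z < t ] (δ (s z) u * δ (r z) v)

  mult-unoccupied : ∀ r u v → mult r u v ≡ 0 → ∀ w → s w ≡ u → ¬ r w ≡ v
  mult-unoccupied r u v m≡0 w refl refl =
    contradiction (trans (sym (cong₂ _*_ (δ-refl (s w)) (δ-refl (r w)))) (∑≡0⇒term≡0 _ m≡0 w)) λ ()

  mult-row : ∀ r u → ∑[ v < q ] mult r u v ≡ ∑[ z < t ] δ (s z) u
  mult-row r u = begin
    ∑[ v < q ] ∑[ z < t ] (δ (s z) u * δ (r z) v)  ≡⟨ ∑-comm (λ v z → δ (s z) u * δ (r z) v) ⟩
    ∑[ z < t ] ∑[ v < q ] (δ (s z) u * δ (r z) v)  ≡⟨ sum-cong-≗ (λ z → *-distribˡ-sum (δ (s z) u) (δ (r z))) ⟨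
    ∑[ z < t ] (δ (s z) u * ∑[ v < q ] δ (r z) v)  ≡⟨ sum-cong-≗ (λ z → cong (δ (s z) u *_) (∑δ≡1 (r z))) ⟩
    ∑[ z < t ] (δ (s z) u * 1)                     ≡⟨ sum-cong-≗ (λ z → *-identityʳ (δ (s z) u)) ⟩
    ∑[ z < t ] δ (s z) u                           ∎
    where open ≡-Reasoning

  mult-column : ∀ r v → ∑[ u < p ] mult r u v ≡ ∑[ z < t ] δ (r z) v
  mult-column r v = begin
    ∑[ u < p ] ∑[ z < t ] (δ (s z) u * δ (r z) v)    ≡⟨ ∑-comm (λ u z → δ (s z) u * δ (r z) v) ⟩
    ∑[ z < t ] ∑[ u < p ] (δ (s z) u * δ (r z) v)    ≡⟨ sum-cong-≗ (λ z → *-distribʳ-sum (δ (r z) v) (δ (s z))) ⟨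
    ∑[ z < t ] ((∑[ u < p ] δ (s z) u) * δ (r z) v)  ≡⟨ sum-cong-≗ (λ z → cong (_* δ (r z) v) (∑δ≡1 (s z))) ⟩
    ∑[ z < t ] (1 * δ (r z) v)                       ≡⟨ sum-cong-≗ (λ z → *-identityˡ (δ (r z) v)) ⟩
    ∑[ z < t ] δ (r z) v                             ∎
    where open ≡-Reasoning

  edge? : (r : Fin t → Fin q) (u : Fin p) (v : Fin q) → Dec (∃ λ z → s z ≡ u × r z ≡ v)
  edge? r u v = any? (λ z → (s z ≟ u) ×-dec (r z ≟ v))

-- F is the adjacency matrix of the edges already present, which must be avoided.
module _ {p q t : ℕ} (s : Fin t → Fin p) (F : Fin p → Fin q → ℕ) where

  Good : (Fin t → Fin q) → Fin t → Set
  Good r z = F (s z) (r z) ≡ 0 × (∀ w → s w ≡ s z → r w ≡ r z → w ≡ z)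

  -- The clause about `w` also covers the two edges to be switched. If both cross positions are
  -- free, then `s x ≢ s y` and `r x ≢ r y`, since otherwise `x` or `y` would itself occupy one of
  -- them; degenerate switches are thus excluded.
  Free : (Fin t → Fin q) → Fin p → Fin q → Set
  Free r u v = F u v ≡ 0 × (∀ w → s w ≡ u → ¬ r w ≡ v)

  module _ {r x y} (xy-free : Free r (s x) (r y)) (yx-free : Free r (s y) (r x)) where

    switch-good-ends : Good (switch x y r) x × Good (switch x y r) y
    switch-good-ends = (F-x , unique-x) , (F-y , unique-y)
      where
      r′ = switch x y r
      r′x≡ry : r′ x ≡ r y
      r′x≡ry = cong r (transposeˡ x y)
      r′y≡rx : r′ y ≡ r x
      r′y≡rx = cong r (transposeʳ x y)
      F-x : F (s x) (r′ x) ≡ 0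
      F-x = trans (cong (F (s x)) r′x≡ry) (proj₁ xy-free)
      F-y : F (s y) (r′ y) ≡ 0
      F-y = trans (cong (F (s y)) r′y≡rx) (proj₁ yx-free)
      unique-x : ∀ w → s w ≡ s x → r′ w ≡ r′ x → w ≡ x
      unique-x w sw≡sx r′w≡r′x with transpose-cases x y w
      ... | inj₁ (w≡x , _) = w≡x
      ... | inj₂ (inj₁ (refl , e)) =
        contradiction (trans (sym (cong r e)) (trans r′w≡r′x r′x≡ry)) (proj₂ xy-free x refl)
      ... | inj₂ (inj₂ e) =
        contradiction (trans (sym (cong r e)) (trans r′w≡r′x r′x≡ry)) (proj₂ xy-free w sw≡sx)
      unique-y : ∀ w → s w ≡ s y → r′ w ≡ r′ y → w ≡ y
      unique-y w sw≡sy r′w≡r′y with transpose-cases x y w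
      ... | inj₁ (refl , e) =
        contradiction (trans (sym (cong r e)) (trans r′w≡r′y r′y≡rx)) (proj₂ yx-free y refl)
      ... | inj₂ (inj₁ (w≡y , _)) = w≡y
      ... | inj₂ (inj₂ e) =
        contradiction (trans (sym (cong r e)) (trans r′w≡r′y r′y≡rx)) (proj₂ yx-free w sw≡sy)

    -- Repairs are never undone. An edge outside the switch keeps its place and could only become
    -- parallel to `x` or `y`, but these move to positions that were free and hence not occupied by
    -- `z`.
    switch-good : ∀ z → Good r z → Good (switch x y r) z
    switch-good z (F≡0 , unique) with transpose-cases x y z
    ... | inj₁ (refl , _)        = proj₁ switch-good-ends
    ... | inj₂ (inj₁ (refl , _)) = proj₂ switch-good-ends
    ... | inj₂ (inj₂ e) = trans (cong (F (s z) ∘ r) e) F≡0 , unique′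
      where
      r′ = switch x y r
      unique′ : ∀ w → s w ≡ s z → r′ w ≡ r′ z → w ≡ z
      unique′ w sw≡sz r′w≡r′z with transpose-cases x y w | trans r′w≡r′z (cong r e)
      ... | inj₁ (refl , e′)        | eq =
        contradiction (trans (sym eq) (cong r e′)) (proj₂ xy-free z (sym sw≡sz))
      ... | inj₂ (inj₁ (refl , e′)) | eq =
        contradiction (trans (sym eq) (cong r e′)) (proj₂ yx-free z (sym sw≡sz))
      ... | inj₂ (inj₂ e′)          | eq = unique w sw≡sz (trans (sym (cong r e′)) eq)

  module _ {Δ : ℕ} (F-row : ∀ u → sum (F u) ≤ Δ) (F-column : ∀ v → ∑[ u < p ] F u v ≤ Δ)
           (s-fibre : ∀ u → ∑[ z < t ] δ (s z) u ≤ Δ) (large : threshold Δ < t) where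

    -- Pigeonhole: the costs of all `t` candidates add up to at most `threshold Δ`, which is less
    -- than `t`, so some `y` has cost zero, and then both cross positions are free.
    partner : ∀ r → (∀ v → ∑[ z < t ] δ (r z) v ≤ Δ) → ∀ x →
              ∃ λ y → Free r (s x) (r y) × Free r (s y) (r x)
    partner r r-fibre x = choose (any? (λ y → cost y ℕ.≟ 0))
      where
      occupied : Fin p → Fin q → ℕ
      occupied u v = F u v + mult s r u v

      cost : Fin t → ℕ
      cost y = occupied (s x) (r y) + occupied (s y) (r x)

      free : ∀ u v → occupied u v ≡ 0 → Free r u v
      free u v o≡0 = m+n≡0⇒m≡0 (F u v) o≡0 , mult-unoccupied s r u v (m+n≡0⇒n≡0 (F u v) o≡0)

      occupied-row : ∀ u → sum (occupied u) ≤ Δ + Δ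
      occupied-row u = begin
        sum (occupied u)                ≡⟨ ∑-distrib-+ (F u) (mult s r u) ⟩
        sum (F u) + sum (mult s r u)      ≡⟨ cong (sum (F u) +_) (mult-row s r u) ⟩
        sum (F u) + ∑[ z < t ] δ (s z) u ≤⟨ +-mono-≤ (F-row u) (s-fibre u) ⟩
        Δ + Δ                           ∎
        where open ≤-Reasoning

      occupied-column : ∀ v → ∑[ u < p ] occupied u v ≤ Δ + Δ
      occupied-column v = begin
        ∑[ u < p ] occupied u v                         ≡⟨ ∑-distrib-+ (λ u → F u v) (λ u → mult s r u v) ⟩
        ∑[ u < p ] F u v + ∑[ u < p ] mult s r u v        ≡⟨ cong (∑[ u < p ] F u v +_) (mult-column s r v) ⟩
        ∑[ u < p ] F u v + ∑[ z < t ] δ (r z) v         ≤⟨ +-mono-≤ (F-column v) (r-fibre v) ⟩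
        Δ + Δ                                           ∎
        where open ≤-Reasoning

      total-cost : sum cost ≤ threshold Δ
      total-cost = begin
        sum cost                             ≡⟨ ∑-distrib-+ (occupied (s x) ∘ r) (λ y → occupied (s y) (r x)) ⟩
        sum (occupied (s x) ∘ r) + ∑[ y < t ] occupied (s y) (r x)
          -- As `y` runs over all edges, each `v` arises as `r y` at most `Δ` times, so the first
          -- sum is at most `Δ` times a row total of `occupied`; the second likewise with columns.
          ≤⟨ +-mono-≤ (∑-∘-≤ r (occupied (s x)) r-fibre (occupied-row (s x)))
                      (∑-∘-≤ s (λ u → occupied u (r x)) s-fibre (occupied-column (r x))) ⟩
        threshold Δ                          ∎
        where open ≤-Reasoning

      choose : Dec (∃ λ y → cost y ≡ 0) → ∃ λ y → Free r (s x) (r y) × Free r (s y) (r x)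
      choose (yes (y , cost≡0)) =
        y , free _ _ (m+n≡0⇒m≡0 _ cost≡0) , free _ _ (m+n≡0⇒n≡0 (occupied (s x) (r y)) cost≡0)
      choose (no cost≢0) = contradiction large (≤⇒≯ (begin
        t               ≡⟨ ∑-one t ⟨
        ∑[ y < t ] 1    ≤⟨ ∑-mono (λ y → n≢0⇒n>0 (λ cost≡0 → cost≢0 (y , cost≡0))) ⟩
        sum cost        ≤⟨ total-cost ⟩
        threshold Δ     ∎))
        where open ≤-Reasoning

    -- The listed edges are switched one after another, without testing whether they are good
    -- already. A switch permutes the values of `r`, so the column degrees, and with them the
    -- hypothesis of `partner`, survive.
    make-good : ∀ r → (∀ v → ∑[ z < t ] δ (r z) v ≤ Δ) → ∀ xs →
                ∃ λ r′ → (∀ v → ∑[ z < t ] δ (r′ z) v ≡ ∑[ z < t ] δ (r z) v) × All (Good r′) xs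
    make-good r r-fibre []       = r , (λ _ → refl) , []
    make-good r r-fibre (x ∷ xs)
      with r₁ , same , good ← make-good r r-fibre xs
      with y , xy , yx ← partner r₁ (λ v → subst (_≤ Δ) (sym (same v)) (r-fibre v)) x
      = switch x y r₁
      , (λ v → trans (sym (sum-permute (λ z → δ (r₁ z) v) (transpose x y))) (same v))
      , proj₁ (switch-good-ends xy yx) ∷ All.map (switch-good xy yx _) good

  -- If all edges are good, no two are parallel; the multiplicities are then 0 or 1, and `mult-row`
  -- and `mult-column` give the degrees of a simple graph.
  mult-simple : ∀ r → (∀ z → Good r z) → ∀ u v → mult s r u v ≡ ⟦ ⌊ edge? s r u v ⌋ ⟧
  mult-simple r good u v with edge? s r u v
  ... | no ∄z = ∑-zero none
    where
    none : ∀ z → δ (s z) u * δ (r z) v ≡ 0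
    none z with s z ≟ u
    ... | no _   = refl
    ... | yes eq = trans (+-identityʳ _) (δ-≢ (λ eq′ → ∄z (z , eq , eq′)))
  ... | yes (z , refl , refl) = trans (sum-cong-≗ only) (∑δ≡1 z)
    where
    only : ∀ w → δ (s w) (s z) * δ (r w) (r z) ≡ δ z w
    only w with s w ≟ s z | r w ≟ r z
    ... | no s≢  | _      = sym (δ-≢ (λ z≡w → s≢ (cong s (sym z≡w))))
    ... | yes _  | no r≢  = sym (δ-≢ (λ z≡w → r≢ (cong r (sym z≡w))))
    ... | yes s≡ | yes r≡ = sym (trans (cong (δ z) (proj₂ (good z) w s≡ r≡)) (δ-refl z))

-- The configuration method: list the ends prescribed by `d` and by `e`, pair them in order, and let
-- `make-good` remove the collisions. Equal totals make the two lists equally long.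
completion : ∀ {p q Δ} (F : Fin p → Fin q → ℕ) (d : Fin p → ℕ) (e : Fin q → ℕ) →
             (∀ u → sum (F u) ≤ Δ) → (∀ v → ∑[ u < p ] F u v ≤ Δ) →
             (∀ u → d u ≤ Δ) → (∀ v → e v ≤ Δ) →
             sum d ≡ sum e → threshold Δ < sum d →
             Σ (Fin p → Fin q → Bool) λ A →
               (∀ u → ∑[ v < q ] ⟦ A u v ⟧ ≡ d u) ×
               (∀ v → ∑[ u < p ] ⟦ A u v ⟧ ≡ e v) ×
               (∀ u v → A u v ≡ true → F u v ≡ 0)
completion {p} {q} {Δ} F d e F-row F-column d≤Δ e≤Δ ∑d≡∑e large
  with s , s-fibre ← fibres d
  with r₀ , r₀-fibre ← subst (λ t → Σ (Fin t → Fin q) λ r → ∀ v → ∑[ z < t ] δ (r z) v ≡ e v)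
                             (sym ∑d≡∑e) (fibres e)
  with r , same , good ← make-good s F F-row F-column
                           (λ u → subst (_≤ Δ) (sym (s-fibre u)) (d≤Δ u)) large
                           r₀ (λ v → subst (_≤ Δ) (sym (r₀-fibre v)) (e≤Δ v)) (allFin (sum d))
  = (λ u v → ⌊ edge? s r u v ⌋)
  , (λ u → trans (sum-cong-≗ (λ v → sym (simple u v))) (trans (mult-row s r u) (s-fibre u)))
  , (λ v → trans (sum-cong-≗ (λ u → sym (simple u v)))
             (trans (mult-column s r v) (trans (same v) (r₀-fibre v))))
  , avoids
  where
  all-good : ∀ z → Good s F r z
  all-good z = All.lookup good (∈-allFin z)

  simple : ∀ u v → mult s r u v ≡ ⟦ ⌊ edge? s r u v ⌋ ⟧
  simple = mult-simple s F r all-good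

  avoids : ∀ u v → ⌊ edge? s r u v ⌋ ≡ true → F u v ≡ 0
  avoids u v _ with yes (z , refl , refl) ← edge? s r u v = proj₁ (all-good z)

-- Edge counts, and removing or adding one edge type.

classSum : ∀ {p m} (f : Fin p → Fin m) {M : Fin m → ℕ} →
           (∀ j → countB (λ u → ⌊ f u ≟ j ⌋) ≡ M j) →
           ∀ g → ∑[ u < p ] g (f u) ≡ ∑[ j < m ] (M j * g j)
classSum f size g = trans (∑-∘ f g)
  (sum-cong-≗ (λ j → cong (_* g j) (trans (sym (countB-∑ (λ u → ⌊ f u ≟ j ⌋))) (size j))))

countB-cong : ∀ {n} {f g : Fin n → Bool} → (∀ i → f i ≡ g i) → countB f ≡ countB g
countB-cong {f = f} {g} f≗g =
  trans (countB-∑ f) (trans (sum-cong-≗ (cong ⟦_⟧ ∘ f≗g)) (sym (countB-∑ g)))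

Disjoint : ∀ {ℓ p q} → (Fin ℓ → Fin p → Fin q → Bool) → Set
Disjoint E = ∀ i j u v → E i u v ≡ true → E j u v ≡ true → i ≡ j

bipGraph : ∀ {ℓ p q} (E : Fin ℓ → Fin p → Fin q → Bool) → Disjoint E → BipGraph ℓ p q
bipGraph E E-disjoint = record { E = E ; disjoint = E-disjoint }

flip-exists : ∀ {ℓ m n} {C : Fin ℓ → Fin m → ℕ} {D : Fin ℓ → Fin n → ℕ} {M N} →
              ExistsBiregular C D M N → ExistsBiregular D C N M
flip-exists (p , q , G , pu , pv , rows , columns , sizeU , sizeV) =
  q , p , bipGraph (λ i v u → E G i u v) (λ i j v u → disjoint G i j u v) ,
  pv , pu , columns , rows , sizeV , sizeU

-- Both sides count the edges of type `i`, once by their ends in `U` and once by their ends in `V`.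
balanced : ∀ {ℓ m n} {C : Fin ℓ → Fin m → ℕ} {D : Fin ℓ → Fin n → ℕ} {M N} →
           ExistsBiregular C D M N → ∀ i →
           ∑[ j < m ] (M j * C i j) ≡ ∑[ j < n ] (N j * D i j)
balanced {m = m} {n} {C} {D} {M} {N} (p , q , G , pu , pv , rows , columns , sizeU , sizeV) i = begin
  ∑[ j < m ] (M j * C i j)            ≡⟨ classSum pu sizeU (C i) ⟨
  ∑[ u < p ] C i (pu u)               ≡⟨ sum-cong-≗ (λ u → trans (sym (countB-∑ (E G i u))) (rows i u)) ⟨
  ∑[ u < p ] ∑[ v < q ] ⟦ E G i u v ⟧ ≡⟨ ∑-comm (λ u v → ⟦ E G i u v ⟧) ⟩
  ∑[ v < q ] ∑[ u < p ] ⟦ E G i u v ⟧ ≡⟨ sum-cong-≗ (λ v → trans (sym (countB-∑ (λ u → E G i u v))) (columns i v)) ⟩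
  ∑[ v < q ] D i (pv v)               ≡⟨ classSum pv sizeV (D i) ⟩
  ∑[ j < n ] (N j * D i j)            ∎
  where open ≡-Reasoning

remove-type : ∀ {ℓ m n} {C : Fin (suc ℓ) → Fin m → ℕ} {D : Fin (suc ℓ) → Fin n → ℕ} {M N} i →
              ExistsBiregular C D M N → ExistsBiregular (removeAt C i) (removeAt D i) M N
remove-type i (p , q , G , pu , pv , rows , columns , sizes) =
  p , q ,
  bipGraph (removeAt (E G) i) (λ j k u v e e′ → punchIn-injective i j k (disjoint G _ _ u v e e′)) ,
  pu , pv , rows ∘ punchIn i , columns ∘ punchIn i , sizes

entrySum : ∀ {ℓ m} → (Fin ℓ → Fin m → ℕ) → ℕ
entrySum {ℓ} C = ∑[ i < ℓ ] sum (C i)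

column≤entrySum : ∀ {ℓ m} (C : Fin ℓ → Fin m → ℕ) j → ∑[ i < ℓ ] C i j ≤ entrySum C
column≤entrySum C j = ∑-mono (λ i → term≤∑ (C i) j)

punchIn-cover : ∀ {n} (i : Fin (suc n)) (P : Fin (suc n) → Set) →
                P i → (∀ k → P (punchIn i k)) → ∀ k → P k
punchIn-cover i P Pi Pk k with i ≟ k
... | yes refl = Pi
... | no i≢k   = subst P (punchIn-punchOut i≢k) (Pk (punchOut i≢k))

-- A crude bound: on both sides it dominates each degree of a single type as well as the total
-- degree of a vertex over all types.
degreeBound : ∀ {ℓ m n} → (Fin ℓ → Fin m → ℕ) → (Fin ℓ → Fin n → ℕ) → ℕ
degreeBound C D = entrySum C + entrySum D

insert-type : ∀ {ℓ m n p q} (C : Fin (suc ℓ) → Fin m → ℕ) (D : Fin (suc ℓ) → Fin n → ℕ) {M N} i₀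
              (G : BipGraph ℓ p q) (A : Fin p → Fin q → Bool) pu pv →
              (∀ u → countB (A u) ≡ C i₀ (pu u)) → (∀ v → countB (λ u → A u v) ≡ D i₀ (pv v)) →
              (∀ u v → A u v ≡ true → ∀ i → E G i u v ≢ true) →
              IsBiregularOfSize (removeAt C i₀) (removeAt D i₀) M N G pu pv → ExistsBiregular C D M N
insert-type {p = p} {q} C D i₀ G A pu pv A-row A-column A-avoids (rows , columns , sizes) =
  p , q , bipGraph E′ E′-disjoint , pu , pv ,
  punchIn-cover i₀ (λ i → ∀ u → countB (E′ i u) ≡ C i (pu u))
    (λ u → trans (cong (λ B → countB (B u)) E′-new) (A-row u))
    (λ k u → trans (cong (λ B → countB (B u)) (E′-old k)) (rows k u)) ,
  punchIn-cover i₀ (λ i → ∀ v → countB (λ u → E′ i u v) ≡ D i (pv v))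
    (λ v → trans (cong (λ B → countB (λ u → B u v)) E′-new) (A-column v))
    (λ k v → trans (cong (λ B → countB (λ u → B u v)) (E′-old k)) (columns k v)) ,
  sizes
  where
  E′ = insertAt (E G) i₀ A

  E′-new : E′ i₀ ≡ A
  E′-new = insertAt-lookup (E G) i₀ A

  E′-old : ∀ k → E′ (punchIn i₀ k) ≡ E G k
  E′-old = insertAt-punchIn (E G) i₀ A

  new-old : ∀ {k u v} → E′ i₀ u v ≡ true → E′ (punchIn i₀ k) u v ≢ true
  new-old {k} {u} {v} new old =
    A-avoids u v (trans (cong (λ B → B u v) (sym E′-new)) new)
      k (trans (cong (λ B → B u v) (sym (E′-old k))) old)

  E′-disjoint : Disjoint E′
  E′-disjoint = punchIn-cover i₀ _
    (punchIn-cover i₀ _ (λ _ _ _ _ → refl) (λ k u v new old → contradiction old (new-old new)))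
    (λ j → punchIn-cover i₀ _ (λ u v old new → contradiction old (new-old new))
      (λ k u v e e′ → cong (punchIn i₀) (disjoint G j k u v
        (trans (cong (λ B → B u v) (sym (E′-old j))) e)
        (trans (cong (λ B → B u v) (sym (E′-old k))) e′))))

-- The old types are merged into one matrix `F`. Its row and column sums, and the degrees of type
-- `i₀`, are at most `degreeBound C D`, so `completion` applies; where the sum `F u v` is zero, no
-- old type has an edge.
add-type : ∀ {ℓ m n} (C : Fin (suc ℓ) → Fin m → ℕ) (D : Fin (suc ℓ) → Fin n → ℕ) {M N} i₀ →
           ∑[ j < m ] (M j * C i₀ j) ≡ ∑[ j < n ] (N j * D i₀ j) →
           threshold (degreeBound C D) < ∑[ j < m ] (M j * C i₀ j) →
           ExistsBiregular (removeAt C i₀) (removeAt D i₀) M N → ExistsBiregular C D M N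
add-type {ℓ} C D i₀ bal large
         (p , q , G , pu , pv , reg@(rows , columns , sizeU , sizeV)) =
  let A , A-row , A-column , A-avoids =
        completion {Δ = degreeBound C D} F (C i₀ ∘ pu) (D i₀ ∘ pv) F-row F-column
          (λ u → ≤-trans (m≤m+n _ _) (C-column (pu u))) (λ v → ≤-trans (m≤m+n _ _) (D-column (pv v)))
          (trans (classSum pu sizeU (C i₀)) (trans bal (sym (classSum pv sizeV (D i₀)))))
          (subst (threshold (degreeBound C D) <_) (sym (classSum pu sizeU (C i₀))) large)
  in insert-type C D i₀ G A pu pv
       (λ u → trans (countB-∑ (A u)) (A-row u))
       (λ v → trans (countB-∑ (λ u → A u v)) (A-column v))
       (λ u v a i e → contradiction
          (trans (cong ⟦_⟧ (sym e)) (∑≡0⇒term≡0 (λ i → ⟦ E G i u v ⟧) (A-avoids u v a) i)) λ ())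
       reg
  where
  F : Fin p → Fin q → ℕ
  F u v = ∑[ i < ℓ ] ⟦ E G i u v ⟧

  C-column : ∀ j → C i₀ j + ∑[ i < ℓ ] C (punchIn i₀ i) j ≤ degreeBound C D
  C-column j = ≤-trans (≤-reflexive (sym (sum-remove {i = i₀} (λ i → C i j))))
    (≤-trans (column≤entrySum C j) (m≤m+n _ _))

  D-column : ∀ j → D i₀ j + ∑[ i < ℓ ] D (punchIn i₀ i) j ≤ degreeBound C D
  D-column j = ≤-trans (≤-reflexive (sym (sum-remove {i = i₀} (λ i → D i j))))
    (≤-trans (column≤entrySum D j) (m≤n+m _ (entrySum C)))

  F-row : ∀ u → sum (F u) ≤ degreeBound C D
  F-row u = begin
    sum (F u)                                ≡⟨ ∑-comm (λ v i → ⟦ E G i u v ⟧) ⟩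
    ∑[ i < ℓ ] ∑[ v < q ] ⟦ E G i u v ⟧      ≡⟨ sum-cong-≗ (λ i → trans (sym (countB-∑ (E G i u))) (rows i u)) ⟩
    ∑[ i < ℓ ] C (punchIn i₀ i) (pu u)       ≤⟨ ≤-trans (m≤n+m _ _) (C-column (pu u)) ⟩
    degreeBound C D                                 ∎
    where open ≤-Reasoning

  F-column : ∀ v → ∑[ u < p ] F u v ≤ degreeBound C D
  F-column v = begin
    ∑[ u < p ] F u v                         ≡⟨ ∑-comm (λ u i → ⟦ E G i u v ⟧) ⟩
    ∑[ i < ℓ ] ∑[ u < p ] ⟦ E G i u v ⟧      ≡⟨ sum-cong-≗ (λ i → trans (sym (countB-∑ (λ u → E G i u v))) (columns i v)) ⟩
    ∑[ i < ℓ ] D (punchIn i₀ i) (pv v)       ≤⟨ ≤-trans (m≤n+m _ _) (D-column (pv v)) ⟩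
    degreeBound C D                                 ∎
    where open ≤-Reasoning

-- Changing the number of isolated vertices.

-- `f` enumerates the elements satisfying `P`. That it meets each of them exactly once is expressed
-- as invariance of sums, the form in which degrees and class sizes use it.
restrict : ∀ {p} {P : Fin p → Set} → (∀ u → Dec (P u)) →
           ∃ λ p′ → Σ (Fin p′ → Fin p) λ f → (∀ u → P (f u)) ×
             (∀ g → (∀ u → ¬ P u → g u ≡ 0) → sum (g ∘ f) ≡ sum g)
restrict {zero}  P? = 0 , (λ ()) , (λ ()) , (λ _ _ → refl)
restrict {suc p} P? with restrict (P? ∘ suc) | P? zero
... | p′ , f , Pf , f-sum | yes P0 =
  suc p′ , zero ∷ᶠ (suc ∘ f) , (λ { zero → P0 ; (suc u) → Pf u }) ,
  (λ g g≡0 → cong (g zero +_) (f-sum (g ∘ suc) (g≡0 ∘ suc)))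
... | p′ , f , Pf , f-sum | no ¬P0 =
  p′ , suc ∘ f , Pf ,
  (λ g g≡0 → trans (f-sum (g ∘ suc) (g≡0 ∘ suc)) (cong (_+ sum (g ∘ suc)) (sym (g≡0 zero ¬P0))))

++-all : ∀ {A : Set} {m n} (P : A → Set) (f : Fin m → A) (g : Fin n → A) →
         (∀ i → P (f i)) → (∀ j → P (g j)) → ∀ k → P ((f ++ g) k)
++-all {m = m} P f g Pf Pg k with splitAt m k
... | inj₁ i = Pf i
... | inj₂ j = Pg j

Active : ∀ {ℓ m} → (Fin ℓ → Fin m → ℕ) → Fin m → Set
Active C j = ∃ λ i → C i j ≢ 0

active? : ∀ {ℓ m} (C : Fin ℓ → Fin m → ℕ) j → Dec (Active C j)
active? C j = any? (λ i → ¬? (C i j ℕ.≟ 0))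

inactive-zero : ∀ {ℓ m} (C : Fin ℓ → Fin m → ℕ) {j} → ¬ Active C j → ∀ i → C i j ≡ 0
inactive-zero C {j} ¬active i = decidable-stable (C i j ℕ.≟ 0) (λ ≢0 → ¬active (i , ≢0))

-- Vertices of inactive classes have no edges. They are all deleted, and `M′ j` fresh isolated
-- vertices are put into each inactive class `j`; degrees on the other side do not change.
resizeU : ∀ {ℓ m n} {C : Fin ℓ → Fin m → ℕ} {D : Fin ℓ → Fin n → ℕ} {M M′ N} →
          (∀ j → Active C j → M j ≡ M′ j) → ExistsBiregular C D M N → ExistsBiregular C D M′ N
resizeU {ℓ} {m} {n} {C} {D} {M} {M′} M≡M′ (p , q , G , pu , pv , rows , columns , sizeU , sizeV)
  with p′ , f , f-active , f-sum ← restrict (active? C ∘ pu)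
  = p′ + sum T , q
  , bipGraph (λ i u → edges (vertex u) i) (λ i j u v → proj₁ (vertex-ok u) i j v)
  , class ∘ vertex , pv
  , (λ i u → proj₂ (vertex-ok u) i)
  , (λ i v → trans (countB-∑ (λ u → edges (vertex u) i v)) (trans (column i v) (columns i v)))
  , (λ j → trans (countB-∑ (λ u → ⌊ class (vertex u) ≟ j ⌋)) (size j))
  , sizeV
  where
  -- A vertex carries its class and its neighbourhoods, so that old and new vertices form one
  -- concatenated family and every check splits along `_++_`.
  Vertex = Fin m × (Fin ℓ → Fin q → Bool)

  class : Vertex → Fin m
  class = proj₁

  edges : Vertex → Fin ℓ → Fin q → Bool
  edges = proj₂

  -- Active classes get no new vertices, as all their vertices are kept.
  T : Fin m → ℕ
  T j = if ⌊ active? C j ⌋ then 0 else M′ j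

  T-active : ∀ j → Active C j → T j ≡ 0
  T-active j active with active? C j
  ... | yes _      = refl
  ... | no ¬active = contradiction active ¬active

  kept : Fin p′ → Vertex
  kept u = pu (f u) , λ i → E G i (f u)

  isolated : Fin (sum T) → Vertex
  isolated u = proj₁ (fibres T) u , λ _ _ → false

  vertex : Fin (p′ + sum T) → Vertex
  vertex = kept ++ isolated

  vertex-ok : ∀ u → (∀ i j v → edges (vertex u) i v ≡ true → edges (vertex u) j v ≡ true → i ≡ j) ×
                    (∀ i → countB (edges (vertex u) i) ≡ C i (class (vertex u)))
  vertex-ok = ++-all (λ x → (∀ i j v → edges x i v ≡ true → edges x j v ≡ true → i ≡ j) ×
                            (∀ i → countB (edges x i) ≡ C i (class x)))
    kept isolated
    (λ u → (λ i j v → disjoint G i j (f u) v) , λ i → rows i (f u))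
    (λ u → (λ _ _ _ ()) , λ i → trans (countB-∑ {q} (λ _ → false))
      (trans (sum-replicate-zero q) (sym (isolated-zero u i))))
    where
    isolated-zero : ∀ u i → C i (class (isolated u)) ≡ 0
    -- If the class were active, `T` would be zero there and the fibre containing `u` empty.
    isolated-zero u = inactive-zero C (λ active → contradiction
      (trans (sym (δ-refl j)) (∑≡0⇒term≡0 _ (trans (proj₂ (fibres T) j) (T-active j active)) u)) λ ())
      where j = class (isolated u)

  column : ∀ i v → ∑[ u < p′ + sum T ] ⟦ edges (vertex u) i v ⟧ ≡ countB (λ u → E G i u v)
  column i v = begin
    ∑[ u < p′ + sum T ] ⟦ edges (vertex u) i v ⟧
      ≡⟨ ∑-++ (λ x → ⟦ edges x i v ⟧) kept isolated ⟩
    ∑[ u < p′ ] ⟦ E G i (f u) v ⟧ + ∑[ u < sum T ] 0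
      ≡⟨ cong₂ _+_ (f-sum (λ u → ⟦ E G i u v ⟧) no-edge) (sum-replicate-zero (sum T)) ⟩
    ∑[ u < p ] ⟦ E G i u v ⟧ + 0
      ≡⟨ +-identityʳ _ ⟩
    ∑[ u < p ] ⟦ E G i u v ⟧
      ≡⟨ countB-∑ (λ u → E G i u v) ⟨
    countB (λ u → E G i u v) ∎
    where
    open ≡-Reasoning
    no-edge : ∀ u → ¬ Active C (pu u) → ⟦ E G i u v ⟧ ≡ 0
    no-edge u ¬active = ∑≡0⇒term≡0 (λ v → ⟦ E G i u v ⟧)
      (trans (sym (countB-∑ (E G i u))) (trans (rows i u) (inactive-zero C ¬active i))) v

  size : ∀ j → ∑[ u < p′ + sum T ] δ (class (vertex u)) j ≡ M′ j
  size j = begin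
    ∑[ u < p′ + sum T ] δ (class (vertex u)) j
      ≡⟨ ∑-++ (λ x → δ (class x) j) kept isolated ⟩
    ∑[ u < p′ ] δ (pu (f u)) j + ∑[ u < sum T ] δ (proj₁ (fibres T) u) j
      ≡⟨ cong (∑[ u < p′ ] δ (pu (f u)) j +_) (proj₂ (fibres T) j) ⟩
    ∑[ u < p′ ] δ (pu (f u)) j + T j
      ≡⟨ kept+T (active? C j) ⟩
    M′ j ∎
    where
    open ≡-Reasoning
    kept+T : (j? : Dec (Active C j)) →
             ∑[ u < p′ ] δ (pu (f u)) j + (if ⌊ j? ⌋ then 0 else M′ j) ≡ M′ j
    kept+T (no ¬active) = cong (_+ M′ j)
      (∑-zero (λ u → δ-≢ (λ eq → ¬active (subst (Active C) eq (f-active u)))))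
    kept+T (yes active) = begin
      ∑[ u < p′ ] δ (pu (f u)) j + 0  ≡⟨ +-identityʳ _ ⟩
      ∑[ u < p′ ] δ (pu (f u)) j      ≡⟨ f-sum (λ u → δ (pu u) j) (λ u ¬active → δ-≢ (λ { refl → ¬active active })) ⟩
      ∑[ u < p ] δ (pu u) j           ≡⟨ countB-∑ (λ u → ⌊ pu u ≟ j ⌋) ⟨
      countB (λ u → ⌊ pu u ≟ j ⌋)     ≡⟨ sizeU j ⟩
      M j                             ≡⟨ M≡M′ j active ⟩
      M′ j                            ∎

resize : ∀ {ℓ m n} {C : Fin ℓ → Fin m → ℕ} {D : Fin ℓ → Fin n → ℕ} {M M′ N N′} →
         (∀ j → Active C j → M j ≡ M′ j) → (∀ j → Active D j → N j ≡ N′ j) →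
         ExistsBiregular C D M N → ExistsBiregular C D M′ N′
resize {C = C} {D} M≡M′ N≡N′ ex =
  flip-exists {C = D} {C} (resizeU {C = D} {C} N≡N′ (flip-exists {C = C} {D} (resizeU {C = C} {D} M≡M′ ex)))

-- Deciding the existence of a graph for given sizes.

Regular : ∀ {ℓ m n p q} (C : Fin ℓ → Fin m → ℕ) (D : Fin ℓ → Fin n → ℕ) (M : Fin m → ℕ) (N : Fin n → ℕ) →
          (Fin p → Fin m) → (Fin q → Fin n) → (Fin ℓ → Fin p → Fin q → Bool) → Set
Regular C D M N pu pv E =
  Σ (Disjoint E) λ E-disjoint → IsBiregularOfSize C D M N (bipGraph E E-disjoint) pu pv

regular? : ∀ {ℓ m n p q} (C : Fin ℓ → Fin m → ℕ) (D : Fin ℓ → Fin n → ℕ) M N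
           (pu : Fin p → Fin m) (pv : Fin q → Fin n) (E : Fin ℓ → Fin p → Fin q → Bool) →
           Dec (Regular C D M N pu pv E)
regular? C D M N pu pv E =
  all? (λ i → all? λ j → all? λ u → all? λ v →
    (E i u v Bool.≟ true) →-dec ((E j u v Bool.≟ true) →-dec (i ≟ j)))
  ×-dec all? (λ i → all? λ u → countB (E i u) ℕ.≟ C i (pu u))
  ×-dec all? (λ i → all? λ v → countB (λ u → E i u v) ℕ.≟ D i (pv v))
  ×-dec all? (λ j → countB (λ u → ⌊ pu u ≟ j ⌋) ℕ.≟ M j)
  ×-dec all? (λ j → countB (λ v → ⌊ pv v ≟ j ⌋) ℕ.≟ N j)

-- Encoding followed by decoding returns functions up to pointwise equality, along which regularity
-- must therefore be transported.
regular-resp : ∀ {ℓ m n p q} (C : Fin ℓ → Fin m → ℕ) (D : Fin ℓ → Fin n → ℕ) {M N}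
               {pu pu′ : Fin p → Fin m} {pv pv′ : Fin q → Fin n} {E E′ : Fin ℓ → Fin p → Fin q → Bool} →
               pu ≗ pu′ → pv ≗ pv′ → (∀ i u v → E i u v ≡ E′ i u v) →
               Regular C D M N pu pv E → Regular C D M N pu′ pv′ E′
regular-resp C D pu≗ pv≗ E≗ (E-disjoint , rows , columns , sizeU , sizeV) =
  (λ i j u v e e′ → E-disjoint i j u v (trans (E≗ i u v) e) (trans (E≗ j u v) e′)) ,
  (λ i u → trans (sym (countB-cong (E≗ i u))) (trans (rows i u) (cong (C i) (pu≗ u)))) ,
  (λ i v → trans (sym (countB-cong (λ u → E≗ i u v))) (trans (columns i v) (cong (D i) (pv≗ v)))) ,
  (λ j → trans (countB-cong (λ u → cong (λ k → ⌊ k ≟ j ⌋) (sym (pu≗ u)))) (sizeU j)) ,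
  (λ j → trans (countB-cong (λ v → cong (λ k → ⌊ k ≟ j ⌋) (sym (pv≗ v)))) (sizeV j))

-- The codes range over a finite set that covers all families of `ℓ` Boolean matrices, so that
-- `any?` can search through them.
decode : ∀ {ℓ p q} → Fin (((2 ^ q) ^ p) ^ ℓ) → Fin ℓ → Fin p → Fin q → Bool
decode c i u v = Inverse.to 2↔Bool (finToFun (finToFun (finToFun c i) u) v)

encode : ∀ {ℓ p q} → (Fin ℓ → Fin p → Fin q → Bool) → Fin (((2 ^ q) ^ p) ^ ℓ)
encode E = funToFin (λ i → funToFin (λ u → funToFin (λ v → Inverse.from 2↔Bool (E i u v))))

decode-encode : ∀ {ℓ p q} (E : Fin ℓ → Fin p → Fin q → Bool) i u v → decode (encode E) i u v ≡ E i u v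
decode-encode E i u v = trans
  (cong (Inverse.to 2↔Bool) (trans
    (cong (λ c → finToFun (finToFun c u) v) (finToFun-funToFin _ i))
    (trans (cong (λ c → finToFun c v) (finToFun-funToFin _ u)) (finToFun-funToFin _ v))))
  (Inverse.strictlyInverseˡ 2↔Bool (E i u v))

-- The sizes thus determine the numbers of vertices, which makes the search space for a graph
-- finite.
classes-total : ∀ {p m} (f : Fin p → Fin m) {M : Fin m → ℕ} →
                (∀ j → countB (λ u → ⌊ f u ≟ j ⌋) ≡ M j) → p ≡ sum M
classes-total {p} f {M} size = trans (sym (∑-one p))
  (trans (classSum f size (λ _ → 1)) (sum-cong-≗ (λ j → *-identityʳ (M j))))

decideBiregular : ∀ {ℓ m n} (C : Fin ℓ → Fin m → ℕ) (D : Fin ℓ → Fin n → ℕ) M N →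
                  Dec (ExistsBiregular C D M N)
decideBiregular {ℓ} C D M N = map′ sound complete
  (any? λ a → any? λ b → any? λ c → regular? C D M N (finToFun a) (finToFun b) (decode c))
  where
  Code = ∃ λ a → ∃ λ b → ∃ λ c →
    Regular {p = sum M} {sum N} C D M N (finToFun a) (finToFun b) (decode c)

  sound : Code → ExistsBiregular C D M N
  sound (_ , _ , _ , E-disjoint , reg) = _ , _ , bipGraph _ E-disjoint , _ , _ , reg

  complete : ExistsBiregular C D M N → Code
  complete (p , q , G , pu , pv , reg@(_ , _ , sizeU , sizeV))
    with refl ← classes-total pu sizeU | refl ← classes-total pv sizeV
    = funToFin pu , funToFin pv , encode (E G)
    , regular-resp C D (λ u → sym (finToFun-funToFin pu u)) (λ v → sym (finToFun-funToFin pv v))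
        (λ i u v → sym (decode-encode (E G) i u v)) (disjoint G , reg)

-- Sealed: otherwise checking satisfaction proofs unfolds the search.
abstract
  existsBiregular? : ∀ {ℓ m n} (C : Fin ℓ → Fin m → ℕ) (D : Fin ℓ → Fin n → ℕ) M N →
                     Dec (ExistsBiregular C D M N)
  existsBiregular? = decideBiregular

-- Presburger terms and formulas.

numeral : ∀ {k} → ℕ → Term k
numeral zero    = `0
numeral (suc n) = `1 `+ numeral n

evalT-numeral : ∀ {k} n (ρ : Fin k → ℕ) → evalT (numeral n) ρ ≡ n
evalT-numeral zero    ρ = refl
evalT-numeral (suc n) ρ = cong suc (evalT-numeral n ρ)

scale : ∀ {k} → Term k → ℕ → Term k
scale t zero    = `0
scale t (suc n) = t `+ scale t n

evalT-scale : ∀ {k} (t : Term k) n ρ → evalT (scale t n) ρ ≡ evalT t ρ * n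
evalT-scale t zero    ρ = sym (*-zeroʳ (evalT t ρ))
evalT-scale t (suc n) ρ = trans (cong (evalT t ρ +_) (evalT-scale t n ρ)) (sym (*-suc (evalT t ρ) n))

linear : ∀ {k m} → (Fin m → Fin k) → (Fin m → ℕ) → Term k
linear {m = zero}  x c = `0
linear {m = suc m} x c = scale (var (x zero)) (c zero) `+ linear (x ∘ suc) (c ∘ suc)

evalT-linear : ∀ {k m} (x : Fin m → Fin k) c ρ → evalT (linear x c) ρ ≡ ∑[ j < m ] (ρ (x j) * c j)
evalT-linear {m = zero}  x c ρ = refl
evalT-linear {m = suc m} x c ρ =
  cong₂ _+_ (evalT-scale (var (x zero)) (c zero) ρ) (evalT-linear (x ∘ suc) (c ∘ suc) ρ)

⋁ : ∀ {k n} → (Fin n → Formula k) → Formula k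
⋁ {n = zero}  φ = `⊥
⋁ {n = suc n} φ = φ zero `∨ ⋁ (φ ∘ suc)

⋁-intro : ∀ {k n} (φ : Fin n → Formula k) ρ i → Sat (φ i) ρ → Sat (⋁ φ) ρ
⋁-intro φ ρ zero    sat = inj₁ sat
⋁-intro φ ρ (suc i) sat = inj₂ (⋁-intro (φ ∘ suc) ρ i sat)

⋁-elim : ∀ {k n} (φ : Fin n → Formula k) ρ → Sat (⋁ φ) ρ → ∃ λ i → Sat (φ i) ρ
⋁-elim {n = suc n} φ ρ (inj₁ sat) = zero , sat
⋁-elim {n = suc n} φ ρ (inj₂ sat) with i , sat′ ← ⋁-elim (φ ∘ suc) ρ sat = suc i , sat′

⋀ : ∀ {k n} → (Fin n → Formula k) → Formula k
⋀ {n = zero}  φ = `⊤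
⋀ {n = suc n} φ = φ zero `∧ ⋀ (φ ∘ suc)

⋀-intro : ∀ {k n} (φ : Fin n → Formula k) ρ → (∀ i → Sat (φ i) ρ) → Sat (⋀ φ) ρ
⋀-intro {n = zero}  φ ρ sat = tt
⋀-intro {n = suc n} φ ρ sat = sat zero , ⋀-intro (φ ∘ suc) ρ (sat ∘ suc)

⋀-elim : ∀ {k n} (φ : Fin n → Formula k) ρ → Sat (⋀ φ) ρ → ∀ i → Sat (φ i) ρ
⋀-elim φ ρ (sat , _) zero    = sat
⋀-elim φ ρ (_ , sat) (suc i) = ⋀-elim (φ ∘ suc) ρ sat i

-- The decision is taken while the formula is being built: `P` does not depend on the valuation, and
-- only its truth value enters.
⌜_⌝ : ∀ {k} {P : Set} → Dec P → Formula k
⌜ P? ⌝ = if ⌊ P? ⌋ then `⊤ else `⊥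

⌜⌝-intro : ∀ {k} {P : Set} (P? : Dec P) (ρ : Fin k → ℕ) → P → Sat ⌜ P? ⌝ ρ
⌜⌝-intro (yes _) ρ _ = tt
⌜⌝-intro (no ¬P) ρ P = contradiction P ¬P

⌜⌝-elim : ∀ {k} {P : Set} (P? : Dec P) (ρ : Fin k → ℕ) → Sat ⌜ P? ⌝ ρ → P
⌜⌝-elim (yes P) ρ _ = P

-- Sizes of inactive classes stay unconstrained, in accordance with `resize`.
agree : ∀ {k ℓ m} → (Fin m → Fin k) → (Fin ℓ → Fin m → ℕ) → (Fin m → ℕ) → Formula k
agree x C M = ⋀ (λ j → ⌜ active? C j ⌝ `⇒ (var (x j) `≡ numeral (M j)))

agree-intro : ∀ {k ℓ m} (x : Fin m → Fin k) (C : Fin ℓ → Fin m → ℕ) M ρ →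
              (∀ j → Active C j → ρ (x j) ≡ M j) → Sat (agree x C M) ρ
agree-intro x C M ρ eq = ⋀-intro _ ρ (λ j sat →
  trans (eq j (⌜⌝-elim (active? C j) ρ sat)) (sym (evalT-numeral (M j) ρ)))

agree-elim : ∀ {k ℓ m} (x : Fin m → Fin k) (C : Fin ℓ → Fin m → ℕ) M ρ →
             Sat (agree x C M) ρ → ∀ j → Active C j → ρ (x j) ≡ M j
agree-elim x C M ρ sat j active =
  trans (⋀-elim _ ρ sat j (⌜⌝-intro (active? C j) ρ active)) (evalT-numeral (M j) ρ)

-- The formula and its correctness.

-- Truncation yields a total map into a finite range; it is exact for sizes up to `K`, and only the
-- sizes of active classes have to be reproduced.
clip : ∀ K → ℕ → Fin (suc K)
clip K x = fromℕ< (s≤s (m⊓n≤n x K))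

toℕ-clip : ∀ {K x} → x ≤ K → toℕ (clip K x) ≡ x
toℕ-clip {K} {x} x≤K = trans (toℕ-fromℕ< (s≤s (m⊓n≤n x K))) (m≤n⇒m⊓n≡m x≤K)

-- For a type `i` with `C i j` positive, the term of class `j` in the edge count is at least `M j`.
active-size≤ : ∀ {ℓ m K} (C : Fin ℓ → Fin m → ℕ) (M : Fin m → ℕ) →
               (∀ i → ∑[ j < m ] (M j * C i j) ≤ K) → ∀ j → Active C j → M j ≤ K
active-size≤ C M small j (i , Cij≢0) = ≤-trans (m≤m*n (M j) (C i j) {{≢-nonZero Cij≢0}})
  (≤-trans (term≤∑ (λ j → M j * C i j) j) (small i))

values : ∀ {K m} → Fin (suc K ^ m) → Fin m → ℕ
values c j = toℕ (finToFun c j)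

clip-values : ∀ {ℓ m K} (C : Fin ℓ → Fin m → ℕ) (M : Fin m → ℕ) →
              (∀ i → ∑[ j < m ] (M j * C i j) ≤ K) →
              ∀ j → Active C j → M j ≡ values (funToFin (clip K ∘ M)) j
clip-values {K = K} C M small j active = sym (trans
  (cong toℕ (finToFun-funToFin (clip K ∘ M) j)) (toℕ-clip (active-size≤ C M small j active)))

module _ {m n : ℕ} where

  X : Fin m → Fin (m + n)
  X j = j ↑ˡ n

  Y : Fin n → Fin (m + n)
  Y j = m ↑ʳ j

  module _ {ℓ} (C : Fin ℓ → Fin m → ℕ) (D : Fin ℓ → Fin n → ℕ) (K : ℕ) where

    -- Some graph has sizes (a , b), and (X , Y) agrees with (a , b) except on the
    -- classes of isolated vertices.
    sporadic : Fin (suc K ^ m) → Fin (suc K ^ n) → Formula (m + n)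
    sporadic a b = ⌜ existsBiregular? C D (values a) (values b) ⌝
                   `∧ (agree X C (values a) `∧ agree Y D (values b))

    small : Formula (m + n)
    small = ⋁ (λ a → ⋁ (sporadic a))

    small-sound : ∀ ρ → Sat small ρ → ExistsBiregular C D (ρ ∘ X) (ρ ∘ Y)
    small-sound ρ sat
      with a , sat₁ ← ⋁-elim (λ a → ⋁ (sporadic a)) ρ sat
      with b , ex , agreeX , agreeY ← ⋁-elim (sporadic a) ρ sat₁
      = resize {C = C} {D}
          (λ j active → sym (agree-elim X C (values a) ρ agreeX j active))
          (λ j active → sym (agree-elim Y D (values b) ρ agreeY j active))
          (⌜⌝-elim (existsBiregular? C D (values a) (values b)) ρ ex)

    small-complete : ∀ ρ → (∀ i → ∑[ j < m ] (ρ (X j) * C i j) ≤ K) →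
                     ExistsBiregular C D (ρ ∘ X) (ρ ∘ Y) → Sat small ρ
    small-complete ρ ≤K ex = ⋁-intro (λ a → ⋁ (sporadic a)) ρ a (⋁-intro (sporadic a) ρ b
      ( ⌜⌝-intro (existsBiregular? C D (values a) (values b)) ρ (resize {C = C} {D} M≡a N≡b ex)
      , agree-intro X C (values a) ρ M≡a
      , agree-intro Y D (values b) ρ N≡b))
      where
      a = funToFin (clip K ∘ ρ ∘ X)
      b = funToFin (clip K ∘ ρ ∘ Y)

      M≡a : ∀ j → Active C j → ρ (X j) ≡ values a j
      M≡a = clip-values C (ρ ∘ X) ≤K

      N≡b : ∀ j → Active D j → ρ (Y j) ≡ values b j
      -- Only the counts on the `U` side are assumed bounded; `balanced` carries the bound over.
      N≡b = clip-values D (ρ ∘ Y) (λ i → subst (_≤ K) (balanced {C = C} {D} ex i) (≤K i))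

  -- The first disjunct handles graphs in which no type exceeds the threshold; `large` picks a type
  -- above it, and the recursion, with the bound recomputed, treats the remaining types. Each
  -- disjunct is sound by itself, so they may overlap.
  biREG : ∀ {ℓ} → (Fin ℓ → Fin m → ℕ) → (Fin ℓ → Fin n → ℕ) → Formula (m + n)
  large : ∀ {ℓ} → (Fin (suc ℓ) → Fin m → ℕ) → (Fin (suc ℓ) → Fin n → ℕ) → Fin (suc ℓ) → Formula (m + n)

  biREG {zero}  C D = small C D (threshold (degreeBound C D))
  biREG {suc ℓ} C D = small C D (threshold (degreeBound C D)) `∨ ⋁ (large C D)

  -- The successor turns `≤` into the strict inequality required by `add-type`.
  large C D i = (numeral (suc (threshold (degreeBound C D))) `≤ linear X (C i))
                `∧ ((linear X (C i) `≡ linear Y (D i)) `∧ biREG (removeAt C i) (removeAt D i))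

  biREG-sound : ∀ {ℓ} (C : Fin ℓ → Fin m → ℕ) (D : Fin ℓ → Fin n → ℕ) ρ →
                Sat (biREG C D) ρ → ExistsBiregular C D (ρ ∘ X) (ρ ∘ Y)
  biREG-sound {zero}  C D ρ sat        = small-sound C D (threshold (degreeBound C D)) ρ sat
  biREG-sound {suc ℓ} C D ρ (inj₁ sat) = small-sound C D (threshold (degreeBound C D)) ρ sat
  biREG-sound {suc ℓ} C D ρ (inj₂ sat) with i , many , bal , sat′ ← ⋁-elim (large C D) ρ sat =
    add-type C D i
      (trans (sym (evalT-linear X (C i) ρ)) (trans bal (evalT-linear Y (D i) ρ)))
      (subst₂ _≤_ (evalT-numeral (suc (threshold (degreeBound C D))) ρ) (evalT-linear X (C i) ρ) many)
      (biREG-sound (removeAt C i) (removeAt D i) ρ sat′)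

  biREG-complete : ∀ {ℓ} (C : Fin ℓ → Fin m → ℕ) (D : Fin ℓ → Fin n → ℕ) ρ →
                   ExistsBiregular C D (ρ ∘ X) (ρ ∘ Y) → Sat (biREG C D) ρ
  -- Without types the bound on edge counts is vacuous.
  biREG-complete {zero}  C D ρ ex = small-complete C D (threshold (degreeBound C D)) ρ (λ ()) ex
  biREG-complete {suc ℓ} C D ρ ex
    with any? (λ i → threshold (degreeBound C D) <? ∑[ j < m ] (ρ (X j) * C i j))
  ... | no none = inj₁ (small-complete C D (threshold (degreeBound C D)) ρ (λ i → ≮⇒≥ (λ many → none (i , many))) ex)
  ... | yes (i , many) = inj₂ (⋁-intro (large C D) ρ i
    ( subst₂ _≤_ (sym (evalT-numeral (suc (threshold (degreeBound C D))) ρ)) (sym (evalT-linear X (C i) ρ)) many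
    , trans (evalT-linear X (C i) ρ)
        (trans (balanced {C = C} {D} ex i) (sym (evalT-linear Y (D i) ρ)))
    , biREG-complete (removeAt C i) (removeAt D i) ρ (remove-type {C = C} {D} i ex)))

theorem8 : (ℓ m n : ℕ) (C : Fin ℓ → Fin m → ℕ) (D : Fin ℓ → Fin n → ℕ) →
    Σ (Formula (m + n)) λ BiREG →
    (M : Fin m → ℕ) (N : Fin n → ℕ) →
    ExistsBiregular C D M N ⇔ Sat BiREG (M ++ N)
theorem8 ℓ m n C D = biREG C D , λ M N → mk⇔
  -- The two halves of `M ++ N` are compared with `M` and `N` pointwise; `resize`, with equality at
  -- all classes, serves as transport.
  (λ ex → biREG-complete C D (M ++ N) (resize {C = C} {D}
    (λ j _ → sym (lookup-++ˡ M N j)) (λ j _ → sym (lookup-++ʳ M N j)) ex))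
  (λ sat → resize {C = C} {D}
    (λ j _ → lookup-++ˡ M N j) (λ j _ → lookup-++ʳ M N j) (biREG-sound C D (M ++ N) sat))
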